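{- For all $r,s,t\in\mathbb{Z}$, the Riordan array $$\left(\frac{1-(r-2t)x-(rt-s-t^2)x^2}{1+(r+2t)x+(rt+s+t^2)x^2},\ \frac{x}{1+(r+2t)x+(rt+s+t^2)x^2}\right)^{ -1}\cdot\left(1,\ \frac{ -x(1+2tx)}{1-(r-2t)x-(rt-s-t^2)x^2}\right)$$ is an involution in the Riordan group.
   Context: Let $\mathbf{k}$ be a field of characteristic zero (e.g. $\mathbb{C}$). $\mathbf{F}_0$ is the set of formal power series $g(x)=g_0+g_1x+g_2x^2+\cdots$ over $\mathbf{k}$ with $g_0\neq 0$; $\mathbf{F}_1$ is the set of formal power series $f(x)=f_1x+f_2x^2+\cdots$ over $\mathbf{k}$ with zero constant term and $f_1\neq 0$. The Riordan group is $\mathcal{R}=\{(g(x),f(x)) : g\in\mathbf{F}_0,\ f\in\mathbf{F}_1\}$ with product $$(g(x),f(x))\cdot(u(x),v(x))=(g(x)\,u(f(x)),\ v(f(x))),$$ identity $(1,x)$, and inverse $(g(x),f(x))^{ -1}=\left(\frac{1}{g(\bar f(x))},\bar f(x)\right)$, where $\bar f$ is the compositional inverse of $f$. Elements of $\mathcal{R}$ are called Riordan arrays (the pair $(g,f)$ is identified with the lower-triangular matrix with $(n,k)$ entry $[x^n]g(x)f(x)^k$, the product corresponding to matrix multiplication). Rational functions are understood as their power series expansions at $x=0$. An involution in $\mathcal{R}$ is an element $A\in\mathcal{R}$ with $A\cdot A=(1,x)$. -}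

module Defs where

open import Algebra.Apartness.Bundles using (HeytingField; module HeytingCommutativeRing)
open import Algebra.Bundles using (CommutativeRing)
import Algebra.Apartness.Properties.HeytingCommutativeRing as HeytingProperties
import Algebra.Properties.Monoid.Mult as MonoidMult
import Algebra.Properties.CommutativeMonoid.Sum as CommutativeMonoidSum
import Algebra.Properties.Ring as RingProperties
open import Data.Fin.Base using (Fin; toℕ; opposite)
open import Data.Fin.Permutation using (reverse)
open import Data.Fin.Properties using (toℕ<n; toℕ≤pred[n]; opposite-prop)
open import Data.Integer.Base using (ℤ; +_; -[1+_]; 0ℤ)
open import Data.Nat.Base using (ℕ; zero; suc; _∸_; _<_; _≤_; z≤n; s≤s)
import Data.Nat.Properties as ℕ
open import Data.Product.Base using (_,_; proj₁; proj₂) renaming (_×_ to _∧_)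
open import Level using (_⊔_)
open import Relation.Binary.PropositionalEquality as ≡ using (_≡_)
open import Relation.Nullary using (¬_; yes; no; contradiction)
import Relation.Binary.Reasoning.Setoid as SetoidReasoning

-- A field is a Heyting field: x # 0 means that x is invertible, and tightness
-- makes ¬ (x # y) equivalent to x ≈ y.  A field with decidable equality is
-- the case where x # y is ¬ (x ≈ y), so # 0# is the "≠ 0" of F₀ and F₁.

module Riordan {c ℓ₁ ℓ₂} (k : HeytingField c ℓ₁ ℓ₂) where

  private
    open HeytingField k
      using (Carrier; _≈_; _#_; _+_; _*_; -_; _-_; 0#; 1#; heytingCommutativeRing;
             #⇒invertible; refl; sym; trans; setoid; reflexive;
             +-cong; +-congˡ; +-congʳ; +-assoc; +-comm; +-identityˡ; +-identityʳ; -‿cong; -‿inverseʳ;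
             *-cong; *-congˡ; *-congʳ; *-assoc; *-comm; *-identityˡ; *-identityʳ; zeroˡ; zeroʳ)
    open CommutativeRing (HeytingCommutativeRing.commutativeRing heytingCommutativeRing)
      using (ring; +-monoid; +-commutativeMonoid)
    open HeytingProperties heytingCommutativeRing
      using (x-0≈x; 1#0; x#0y#0→xy#0; #-congʳ; invertibleʳ⇒#)
    open MonoidMult +-monoid using (_×_)
    open CommutativeMonoidSum +-commutativeMonoid
      using (sum-syntax; sum⁺-syntax; sum-cong-≋; sum-permute)
    open RingProperties ring using (-0#≈0#; -‿distribˡ-*; -‿involutive)

  CharacteristicZero : Set ℓ₁
  CharacteristicZero = ∀ n → ¬ (suc n × 1# ≈ 0#)

  fromℤ : ℤ → Carrier
  fromℤ (+ n)    = n × 1#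
  fromℤ -[1+ n ] = - (suc n × 1#)

  inv : ∀ {x} → x # 0# → Carrier
  inv x#0 = proj₁ (#⇒invertible x#0)

  inv-inverseˡ : ∀ {x} (x#0 : x # 0#) → inv x#0 * x ≈ 1#
  inv-inverseˡ {x} x#0 =
    trans (*-congˡ (sym (x-0≈x x))) (proj₁ (proj₂ (#⇒invertible x#0)))

  inv-inverseʳ : ∀ {x} (x#0 : x # 0#) → x * inv x#0 ≈ 1#
  inv-inverseʳ x#0 = trans (*-comm _ _) (inv-inverseˡ x#0)

  private
    *≈1⇒#ˡ : ∀ {x y} → x * y ≈ 1# → x # 0#
    *≈1⇒#ˡ xy≈1 = invertibleʳ⇒# (_ , trans (*-congʳ (x-0≈x _)) xy≈1)

    *≈1⇒#ʳ : ∀ {x y} → x * y ≈ 1# → y # 0#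
    *≈1⇒#ʳ xy≈1 = *≈1⇒#ˡ (trans (*-comm _ _) xy≈1)

  Series : Set c
  Series = ℕ → Carrier

  infix 4 _≈ˢ_
  _≈ˢ_ : Series → Series → Set ℓ₁
  a ≈ˢ b = ∀ n → a n ≈ b n

  0ˢ : Series
  0ˢ _ = 0#

  1ˢ : Series
  1ˢ zero    = 1#
  1ˢ (suc _) = 0#

  shift : Series → Series
  shift a zero    = 0#
  shift a (suc n) = a n

  xˢ : Series
  xˢ = shift 1ˢ

  infix 8 -ˢ_
  -ˢ_ : Series → Series
  (-ˢ a) n = - a n

  infixl 7 _*ˢ_
  _*ˢ_ : Series → Series → Series
  (a *ˢ b) n = ∑[ i ≤ n ] (a (toℕ i) * b (n ∸ toℕ i))

  infixr 8 _^ˢ_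
  _^ˢ_ : Series → ℕ → Series
  a ^ˢ zero  = 1ˢ
  a ^ˢ suc j = a *ˢ a ^ˢ j

  -- u (v (x)), for v with zero constant term: then [xⁿ] vʲ = 0 for j > n, so
  -- the coefficient of xⁿ in Σⱼ uⱼ vʲ is the finite sum below.
  infixr 9 _∘ˢ_
  _∘ˢ_ : Series → Series → Series
  (u ∘ˢ v) n = ∑[ j ≤ n ] (u (toℕ j) * (v ^ˢ toℕ j) n)

  -- Undetermined coefficients: the solution b of F b = target, for an F where
  -- [xⁿ] F b depends only on b₀ , … , bₙ and is affine in bₙ with slope d,
  -- e being the inverse of d.  partial F n agrees with it below degree n and
  -- is 0 from degree n on.
  module Solve (F : Series → Series) (target : Series) (e : Carrier) where

    next : ℕ → Series → Carrier
    next n b = e * (target n - F b n)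

    partial : ℕ → Series
    partial zero    _ = 0#
    partial (suc n) m with m ℕ.≟ n
    ... | yes _ = next n (partial n)
    ... | no  _ = partial n m

    solution : Series
    solution n = next n (partial n)

    partial-≥ : ∀ {n m} → n ≤ m → partial n m ≡ 0#
    partial-≥ {zero} _ = ≡.refl
    partial-≥ {suc n} {m} n<m with m ℕ.≟ n
    ... | yes ≡.refl = contradiction n<m (ℕ.<-irrefl ≡.refl)
    ... | no  _      = partial-≥ (ℕ.<⇒≤ n<m)

    partial-< : ∀ {n m} → m < n → partial n m ≡ solution m
    partial-< {suc n} {m} (s≤s m≤n) with m ℕ.≟ n
    ... | yes ≡.refl = ≡.refl
    ... | no  m≢n    = partial-< (ℕ.≤∧≢⇒< m≤n m≢n)

    solves : ∀ {d} → d * e ≈ 1# → ∀ n →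
             F solution n ≈ d * solution n + F (partial n) n → F solution n ≈ target n
    solves {d} de≈1 n affine = begin
      F solution n                               ≈⟨ affine ⟩
      d * (e * (target n - r)) + r               ≈⟨ +-congʳ (*-assoc d e _) ⟨
      d * e * (target n - r) + r                 ≈⟨ +-congʳ (*-congʳ de≈1) ⟩
      1# * (target n - r) + r                    ≈⟨ +-congʳ (*-identityˡ _) ⟩
      target n - r + r                           ≈⟨ +-assoc _ _ _ ⟩
      target n + (- r + r)                       ≈⟨ +-congˡ (trans (+-comm _ _) (-‿inverseʳ r)) ⟩
      target n + 0#                              ≈⟨ +-identityʳ _ ⟩
      target n                                   ∎
      where
      open SetoidReasoning setoid
      r = F (partial n) n

  record F₀ : Set (c ⊔ ℓ₂) where
    field
      series : Series
      coeff₀ : series 0 # 0#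

  record F₁ : Set (c ⊔ ℓ₁ ⊔ ℓ₂) where
    field
      series : Series
      coeff₀ : series 0 ≈ 0#
      coeff₁ : series 1 # 0#

  +-vanishʳ : ∀ {x y} → y ≈ 0# → x + y ≈ x
  +-vanishʳ y≈0 = trans (+-congˡ y≈0) (+-identityʳ _)

  +-vanishˡ : ∀ {x y} → x ≈ 0# → x + y ≈ y
  +-vanishˡ x≈0 = trans (+-congʳ x≈0) (+-identityˡ _)

  *-vanishˡ : ∀ {x y} → x ≈ 0# → x * y ≈ 0#
  *-vanishˡ x≈0 = trans (*-congʳ x≈0) (zeroˡ _)

  *-vanishʳ : ∀ {x y} → y ≈ 0# → x * y ≈ 0#
  *-vanishʳ y≈0 = trans (*-congˡ y≈0) (zeroʳ _)

  *ˢ-0 : ∀ a b → (a *ˢ b) 0 ≈ a 0 * b 0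
  *ˢ-0 _ _ = +-identityʳ _

  *ˢ-1 : ∀ a b → a 0 ≈ 0# → (a *ˢ b) 1 ≈ a 1 * b 0
  *ˢ-1 _ _ a₀≈0 = trans (+-vanishˡ (*-vanishˡ a₀≈0)) (+-identityʳ _)

  *ˢ-identityʳ : ∀ a → a *ˢ 1ˢ ≈ˢ a
  *ˢ-identityʳ a zero    = trans (+-identityʳ _) (*-identityʳ _)
  *ˢ-identityʳ a (suc n) = trans (+-vanishˡ (zeroʳ _)) (*ˢ-identityʳ (λ m → a (suc m)) n)

  *ˢ-comm : ∀ a b → a *ˢ b ≈ˢ b *ˢ a
  *ˢ-comm a b n =
    trans (sum-permute {suc n} (λ i → a (toℕ i) * b (n ∸ toℕ i)) reverse) (sum-cong-≋ {suc n} term)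
    where
    term : ∀ (i : Fin (suc n)) →
           a (toℕ (opposite i)) * b (n ∸ toℕ (opposite i)) ≈ b (toℕ i) * a (n ∸ toℕ i)
    term i rewrite opposite-prop i | ℕ.m∸[m∸n]≡n (toℕ≤pred[n] i) = *-comm _ _

  ∘ˢ-0 : ∀ u v → (u ∘ˢ v) 0 ≈ u 0
  ∘ˢ-0 _ _ = trans (+-identityʳ _) (*-identityʳ _)

  ∘ˢ-1 : ∀ u v → (u ∘ˢ v) 1 ≈ u 1 * v 1
  ∘ˢ-1 u v = trans (+-vanishˡ (zeroʳ _)) (trans (+-identityʳ _) (*-congˡ (*ˢ-identityʳ v 1)))

  Agree : ℕ → Series → Series → Set ℓ₁
  Agree n a b = ∀ {m} → m < n → a m ≈ b m

  *ˢ-agree : ∀ {n a a′ b b′} → Agree n a a′ → Agree n b b′ → Agree n (a *ˢ b) (a′ *ˢ b′)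
  *ˢ-agree p q {m} m<n = sum-cong-≋ {suc m} λ i →
    *-cong (p (ℕ.<-≤-trans (toℕ<n i) m<n)) (q (ℕ.≤-<-trans (ℕ.m∸n≤m m (toℕ i)) m<n))

  ^ˢ-agree : ∀ {n a a′} j → Agree n a a′ → Agree n (a ^ˢ j) (a′ ^ˢ j)
  ^ˢ-agree zero    p _ = refl
  ^ˢ-agree (suc j) p   = *ˢ-agree p (^ˢ-agree j p)

  -- With vanishing constant terms, the top coefficients do not contribute.
  *ˢ-agree⁺ : ∀ {n a a′ b b′} → Agree n a a′ → Agree n b b′ →
              a 0 ≈ 0# → a′ 0 ≈ 0# → b 0 ≈ 0# → b′ 0 ≈ 0# → (a *ˢ b) n ≈ (a′ *ˢ b′) n
  *ˢ-agree⁺ {n} {a} {a′} {b} {b′} p q a₀ a′₀ b₀ b′₀ =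
    sum-cong-≋ {suc n} λ i → term (toℕ i) (toℕ≤pred[n] i)
    where
    term : ∀ i → i ≤ n → a i * b (n ∸ i) ≈ a′ i * b′ (n ∸ i)
    term zero _ = trans (*-vanishˡ a₀) (sym (*-vanishˡ a′₀))
    term (suc i) i<n with suc i ℕ.≟ n
    ... | yes ≡.refl rewrite ℕ.n∸n≡0 i = trans (*-vanishʳ b₀) (sym (*-vanishʳ b′₀))
    ... | no  i≢n    =
      *-cong (p (ℕ.≤∧≢⇒< i<n i≢n)) (q (ℕ.∸-monoʳ-< {n} {suc i} {0} (s≤s z≤n) i<n))

  ^ˢ-0 : ∀ {a} j → a 0 ≈ 0# → (a ^ˢ suc j) 0 ≈ 0#
  ^ˢ-0 {a} j a₀ = trans (*ˢ-0 a (a ^ˢ j)) (*-vanishˡ a₀)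

  1₀ : F₀
  1₀ = record { series = 1ˢ ; coeff₀ = 1#0 }

  infixl 7 _*₀_
  _*₀_ : F₀ → F₀ → F₀
  a *₀ b = record
    { series = A.series *ˢ B.series
    ; coeff₀ = #-congʳ (sym (*ˢ-0 A.series B.series)) (x#0y#0→xy#0 A.coeff₀ B.coeff₀)
    }
    where
    module A = F₀ a
    module B = F₀ b

  module Reciprocal (q : F₀) where
    open F₀ q renaming (series to qˢ)
    open Solve (qˢ *ˢ_) 1ˢ (inv coeff₀) public

    inverseʳ : qˢ *ˢ solution ≈ˢ 1ˢ
    inverseʳ n = solves (inv-inverseʳ coeff₀) n (+-congˡ (trans (sum-cong-≋ {n} term)
                   (sym (+-vanishˡ (*-vanishʳ (reflexive (partial-≥ {n} ℕ.≤-refl)))))))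
      where
      term : ∀ (i : Fin n) → qˢ (suc (toℕ i)) * solution (n ∸ suc (toℕ i))
                           ≈ qˢ (suc (toℕ i)) * partial n (n ∸ suc (toℕ i))
      term i = *-congˡ (reflexive (≡.sym (partial-< (ℕ.∸-monoʳ-< {n} (s≤s z≤n) (toℕ<n i)))))

    reciprocal : F₀
    reciprocal = record
      { series = solution
      ; coeff₀ = *≈1⇒#ʳ (trans (sym (*ˢ-0 qˢ solution)) (inverseʳ 0))
      }

  open Reciprocal public using (reciprocal)

  infixl 7 _/₀_
  _/₀_ : F₀ → F₀ → F₀
  a /₀ b = a *₀ reciprocal b

  infix 8 x∙_
  x∙_ : F₀ → F₁
  x∙ a = record { series = shift (F₀.series a) ; coeff₀ = refl ; coeff₁ = F₀.coeff₀ a }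

  x₁ : F₁
  x₁ = x∙ 1₀

  infix 8 -₁_
  -₁_ : F₁ → F₁
  -₁ f = record
    { series = -ˢ series
    ; coeff₀ = trans (-‿cong coeff₀) -0#≈0#
    ; coeff₁ = *≈1⇒#ˡ (neg (inv-inverseʳ coeff₁))
    }
    where
    open F₁ f
    neg : ∀ {x y} → x * y ≈ 1# → - x * - y ≈ 1#
    neg {x} {y} xy≈1 = trans (sym (-‿distribˡ-* x (- y)))
      (trans (-‿cong (trans (*-comm x (- y)) (sym (-‿distribˡ-* y x))))
      (trans (-‿involutive _) (trans (*-comm y x) xy≈1)))

  infixl 7 _/₁_
  _/₁_ : F₁ → F₀ → F₁
  f /₁ b = record
    { series = A.series *ˢ B.series
    ; coeff₀ = trans (*ˢ-0 A.series B.series) (*-vanishˡ A.coeff₀)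
    ; coeff₁ = #-congʳ (sym (*ˢ-1 A.series B.series A.coeff₀)) (x#0y#0→xy#0 A.coeff₁ B.coeff₀)
    }
    where
    module A = F₁ f
    module B = F₀ (reciprocal b)

  infixr 9 _∘₀_ _∘₁_
  _∘₀_ : F₀ → F₁ → F₀
  u ∘₀ f = record
    { series = U.series ∘ˢ F.series
    ; coeff₀ = #-congʳ (sym (∘ˢ-0 U.series F.series)) U.coeff₀
    }
    where
    module U = F₀ u
    module F = F₁ f

  _∘₁_ : F₁ → F₁ → F₁
  v ∘₁ f = record
    { series = V.series ∘ˢ F.series
    ; coeff₀ = trans (∘ˢ-0 V.series F.series) V.coeff₀
    ; coeff₁ = #-congʳ (sym (∘ˢ-1 V.series F.series)) (x#0y#0→xy#0 V.coeff₁ F.coeff₁)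
    }
    where
    module V = F₁ v
    module F = F₁ f

  module CompositionalInverse (f : F₁) where
    open F₁ f renaming (series to fˢ)
    open Solve (fˢ ∘ˢ_) xˢ (inv coeff₁) public

    solution₀ : solution 0 ≈ 0#
    solution₀ = *-vanishʳ (trans (+-vanishˡ refl)
      (trans (-‿cong (trans (∘ˢ-0 fˢ 0ˢ) coeff₀)) -0#≈0#))

    private
      agree : ∀ n → Agree n solution (partial n)
      agree n m<n = reflexive (≡.sym (partial-< m<n))

      top : ∀ n → partial n n ≈ 0#
      top n = reflexive (partial-≥ {n} ℕ.≤-refl)

    inverseʳ : fˢ ∘ˢ solution ≈ˢ xˢ
    inverseʳ zero    = trans (∘ˢ-0 fˢ solution) coeff₀
    inverseʳ (suc n) = solves (inv-inverseʳ coeff₁) (suc n) (begin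
      fˢ 0 * 0# + (fˢ 1 * (solution *ˢ 1ˢ) (suc n) + higher solution)
        ≈⟨ +-vanishˡ (zeroʳ _) ⟩
      fˢ 1 * (solution *ˢ 1ˢ) (suc n) + higher solution
        ≈⟨ +-cong (*-congˡ (*ˢ-identityʳ solution (suc n))) (sum-cong-≋ {n} term) ⟩
      fˢ 1 * solution (suc n) + higher p
        ≈⟨ +-congˡ (+-vanishˡ (*-vanishʳ (trans (*ˢ-identityʳ p (suc n)) (top (suc n))))) ⟨
      fˢ 1 * solution (suc n) + (fˢ 1 * (p *ˢ 1ˢ) (suc n) + higher p)
        ≈⟨ +-congˡ (+-vanishˡ (zeroʳ _)) ⟨
      fˢ 1 * solution (suc n) + (fˢ ∘ˢ p) (suc n) ∎)
      where
      open SetoidReasoning setoid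
      p = partial (suc n)

      higher : Series → Carrier
      higher b = ∑[ j < n ] (fˢ (suc (suc (toℕ j))) * (b ^ˢ suc (suc (toℕ j))) (suc n))

      p₀ : p 0 ≈ 0#
      p₀ = trans (sym (agree (suc n) (s≤s z≤n))) solution₀

      term : ∀ (j : Fin n) → fˢ (suc (suc (toℕ j))) * (solution ^ˢ suc (suc (toℕ j))) (suc n)
                           ≈ fˢ (suc (suc (toℕ j))) * (p ^ˢ suc (suc (toℕ j))) (suc n)
      term j = *-congˡ (*ˢ-agree⁺ {suc n} (agree (suc n)) (^ˢ-agree (suc (toℕ j)) (agree (suc n)))
                 solution₀ p₀ (^ˢ-0 (toℕ j) solution₀) (^ˢ-0 (toℕ j) p₀))

    compInverse : F₁
    compInverse = record
      { series = solution
      ; coeff₀ = solution₀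
      ; coeff₁ = *≈1⇒#ʳ (trans (sym (∘ˢ-1 fˢ solution)) (inverseʳ 1))
      }

  open CompositionalInverse public using (compInverse)

  RiordanArray : Set (c ⊔ ℓ₁ ⊔ ℓ₂)
  RiordanArray = F₀ ∧ F₁

  infix 4 _≈ᴿ_
  _≈ᴿ_ : RiordanArray → RiordanArray → Set ℓ₁
  (g , f) ≈ᴿ (u , v) = (F₀.series g ≈ˢ F₀.series u) ∧ (F₁.series f ≈ˢ F₁.series v)

  infixl 7 _∙_
  _∙_ : RiordanArray → RiordanArray → RiordanArray
  (g , f) ∙ (u , v) = g *₀ u ∘₀ f , v ∘₁ f

  ε : RiordanArray
  ε = 1₀ , x₁

  infix 8 _⁻¹
  _⁻¹ : RiordanArray → RiordanArray
  (g , f) ⁻¹ = reciprocal (g ∘₀ compInverse f) , compInverse f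

  ⁻¹-inverseˡ : ∀ A → A ⁻¹ ∙ A ≈ᴿ ε
  ⁻¹-inverseˡ (g , f) =
    (λ n → trans (*ˢ-comm (F₀.series (reciprocal h)) (F₀.series h) n) (Reciprocal.inverseʳ h n)) ,
    CompositionalInverse.inverseʳ f
    where h = g ∘₀ compInverse f

  IsInvolution : RiordanArray → Set ℓ₁
  IsInvolution A = A ∙ A ≈ᴿ ε

  infix 9 1+[_]x 1+[_]x+[_]x²

  1+[_]x+[_]x² : ℤ → ℤ → F₀
  1+[ a ]x+[ b ]x² = record { series = coefficients ; coeff₀ = 1#0 }
    where
    coefficients : Series
    coefficients 0 = 1#
    coefficients 1 = fromℤ a
    coefficients 2 = fromℤ b
    coefficients _ = 0#

  1+[_]x : ℤ → F₀
  1+[ a ]x = 1+[ a ]x+[ 0ℤ ]x²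

{-# OPTIONS --safe #-}

-- With σ = - x / (1 + 2 t x), a direct computation gives D(σ) (1 + 2 t x)² = N and
-- N(σ) (1 + 2 t x)² = D.  Hence σ is an involution under composition, g = N / D satisfies
-- g · g(σ) = 1, and the second factor of the array is f ∘ σ for f = x / D.  The array is
-- therefore (1 / g(f̄) , f ∘ σ ∘ f̄), with f̄ the compositional inverse of f, and it squares
-- to the identity because σ does.

module Submission where

open import Algebra.Apartness.Bundles using (HeytingField; module HeytingCommutativeRing)
open import Algebra.Bundles using (CommutativeRing)
open import Algebra.Core using (Op₂)
import Algebra.Properties.AbelianGroup as AbelianGroupProperties
import Algebra.Properties.Ring as RingProperties
import Algebra.Properties.Semiring.Mult.TCOptimised as Mult
import Algebra.Properties.Semiring.Sum as SemiringSum
import Algebra.Solver.Ring as RingSolver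
open import Algebra.Solver.Ring.AlmostCommutativeRing using (fromCommutativeRing; _-Raw-AlmostCommutative⟶_)
open import Data.Fin.Base using (toℕ)
import Data.Integer.Base as ℤ
open import Data.Integer.Base using (ℤ; +_; -[1+_]; 1ℤ; +-*-rawRing)
import Data.Integer.Properties as ℤ
open import Data.Integer.Tactic.RingSolver using (solve-∀)
import Data.Maybe.Base as Maybe
open import Data.Nat.Base as ℕ using (ℕ; zero; suc; z≤n; s≤s; _≤_; _∸_)
import Data.Nat.Properties as ℕ
open import Data.Product.Base using (_,_)
open import Level using (Level; Setω; _⊔_)
open import Relation.Binary.PropositionalEquality as ≡ using (_≡_)
import Relation.Binary.Reasoning.Setoid as SetoidReasoning
open import Relation.Nullary.Decidable using (dec⇒maybe)
open import Defs

-- The canonical ring homomorphism from the integers.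

module IntegerCoefficients {c ℓ} (R : CommutativeRing c ℓ) where

  open import Data.Integer.Base using (_⊖_; -_; _+_; _*_)

  private
    module R = CommutativeRing R
    open R using (_≈_; 1#; refl; sym; trans; +-cong; +-congˡ; -‿cong)
    open RingProperties R.ring using (-0#≈0#; -‿involutive; -‿distribˡ-*; -‿distribʳ-*)
    open AbelianGroupProperties R.+-abelianGroup using (⁻¹-∙-comm; xyx⁻¹≈y)
    open Mult R.semiring using (_×_; 1+×; ×-homo-+; ×1-homo-*)

  -- With this version of multiples, `1 × 1#` computes to `1#`, so `con 1ℤ` in a solver equation is
  -- `1#` itself and `1-homo` is `refl`.
  ⟦_⟧ : ℤ → R.Carrier
  ⟦ + n ⟧      = n × 1#
  ⟦ -[1+ n ] ⟧ = R.- (suc n × 1#)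

  ⟦⟧-homo-‿ : ∀ i → ⟦ - i ⟧ ≈ R.- ⟦ i ⟧
  ⟦⟧-homo-‿ (+ zero)  = sym -0#≈0#
  ⟦⟧-homo-‿ (+ suc n) = refl
  ⟦⟧-homo-‿ -[1+ n ]  = sym (-‿involutive _)

  -- Induction on both arguments: a common `1#` is added and subtracted. The sums of integers of
  -- opposite sign reduce to this case.
  ⟦⟧-homo-⊖ : ∀ m n → ⟦ m ⊖ n ⟧ ≈ m × 1# R.- n × 1#
  ⟦⟧-homo-⊖ zero    zero    = sym (R.-‿inverseʳ _)
  ⟦⟧-homo-⊖ zero    (suc n) = sym (R.+-identityˡ _)
  ⟦⟧-homo-⊖ (suc m) zero    = sym (trans (+-congˡ -0#≈0#) (R.+-identityʳ _))
  ⟦⟧-homo-⊖ (suc m) (suc n) = begin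
    ⟦ suc m ⊖ suc n ⟧                           ≡⟨ ≡.cong ⟦_⟧ (ℤ.[1+m]⊖[1+n]≡m⊖n m n) ⟩
    ⟦ m ⊖ n ⟧                                   ≈⟨ ⟦⟧-homo-⊖ m n ⟩
    m × 1# R.- n × 1#                           ≈⟨ xyx⁻¹≈y 1# _ ⟨
    1# R.+ (m × 1# R.- n × 1#) R.- 1#           ≈⟨ R.+-congʳ (R.+-assoc _ _ _) ⟨
    1# R.+ m × 1# R.- n × 1# R.- 1#             ≈⟨ R.+-assoc _ _ _ ⟩
    1# R.+ m × 1# R.+ (R.- (n × 1#) R.- 1#)     ≈⟨ +-congˡ (R.+-comm _ _) ⟩
    1# R.+ m × 1# R.+ (R.- 1# R.- n × 1#)       ≈⟨ +-congˡ (⁻¹-∙-comm _ _) ⟩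
    1# R.+ m × 1# R.- (1# R.+ n × 1#)           ≈⟨ +-cong (1+× m 1#) (-‿cong (1+× n 1#)) ⟨
    suc m × 1# R.- suc n × 1#                   ∎
    where open SetoidReasoning R.setoid

  ⟦⟧-homo-+ : ∀ i j → ⟦ i + j ⟧ ≈ ⟦ i ⟧ R.+ ⟦ j ⟧
  ⟦⟧-homo-+ (+ m)    (+ n)    = ×-homo-+ 1# m n
  ⟦⟧-homo-+ (+ m)    -[1+ n ] = ⟦⟧-homo-⊖ m (suc n)
  ⟦⟧-homo-+ -[1+ m ] (+ n)    = trans (⟦⟧-homo-⊖ n (suc m)) (R.+-comm _ _)
  ⟦⟧-homo-+ -[1+ m ] -[1+ n ] = begin
    R.- (suc (suc (m ℕ.+ n)) × 1#)          ≡⟨ ≡.cong (λ k → R.- (suc k × 1#)) (≡.sym (ℕ.+-suc m n)) ⟩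
    R.- ((suc m ℕ.+ suc n) × 1#)            ≈⟨ -‿cong (×-homo-+ 1# (suc m) (suc n)) ⟩
    R.- (suc m × 1# R.+ suc n × 1#)         ≈⟨ ⁻¹-∙-comm _ _ ⟨
    R.- (suc m × 1#) R.- suc n × 1#         ∎
    where open SetoidReasoning R.setoid

  ⟦⟧-homo-* : ∀ i j → ⟦ i * j ⟧ ≈ ⟦ i ⟧ R.* ⟦ j ⟧
  ⟦⟧-homo-* (+ m) j = pos m j
    where
    open SetoidReasoning R.setoid
    pos : ∀ m j → ⟦ + m * j ⟧ ≈ ⟦ + m ⟧ R.* ⟦ j ⟧
    pos m (+ n)    = trans (R.reflexive (≡.cong ⟦_⟧ (≡.sym (ℤ.pos-* m n)))) (×1-homo-* m n)
    pos m -[1+ n ] = begin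
      ⟦ + m * -[1+ n ] ⟧               ≡⟨ ≡.cong ⟦_⟧ (ℤ.neg-distribʳ-* (+ m) (+ suc n)) ⟨
      ⟦ - (+ m * + suc n) ⟧            ≈⟨ ⟦⟧-homo-‿ (+ m * + suc n) ⟩
      R.- ⟦ + m * + suc n ⟧            ≈⟨ -‿cong (pos m (+ suc n)) ⟩
      R.- (⟦ + m ⟧ R.* ⟦ + suc n ⟧)    ≈⟨ -‿distribʳ-* _ _ ⟩
      ⟦ + m ⟧ R.* R.- ⟦ + suc n ⟧      ∎
  ⟦⟧-homo-* -[1+ m ] j = begin
    ⟦ -[1+ m ] * j ⟧                   ≡⟨ ≡.cong ⟦_⟧ (ℤ.neg-distribˡ-* (+ suc m) j) ⟨
    ⟦ - (+ suc m * j) ⟧                ≈⟨ ⟦⟧-homo-‿ (+ suc m * j) ⟩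
    R.- ⟦ + suc m * j ⟧                ≈⟨ -‿cong (⟦⟧-homo-* (+ suc m) j) ⟩
    R.- (⟦ + suc m ⟧ R.* ⟦ j ⟧)        ≈⟨ -‿distribˡ-* _ _ ⟩
    R.- ⟦ + suc m ⟧ R.* ⟦ j ⟧          ∎
    where open SetoidReasoning R.setoid

  morphism : +-*-rawRing -Raw-AlmostCommutative⟶ fromCommutativeRing R
  morphism = record
    { ⟦_⟧    = ⟦_⟧
    ; +-homo = ⟦⟧-homo-+
    ; *-homo = ⟦⟧-homo-*
    ; -‿homo = ⟦⟧-homo-‿
    ; 0-homo = refl
    ; 1-homo = refl
    }

  -- Normalisation compares coefficients. Equality is decidable for integers but need not be in `R`,
  -- hence integer coefficients.
  module Solver = RingSolver +-*-rawRing (fromCommutativeRing R) morphism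
    (λ i j → Maybe.map (λ i≡j → R.reflexive (≡.cong ⟦_⟧ i≡j)) (dec⇒maybe (i ℤ.≟ j)))

-- Substitution in a commutative ring, axiomatically.

module Substitution {c ℓ p : Level} (R : CommutativeRing c ℓ) where

  open CommutativeRing R
    using (Carrier; _≈_; _+_; _*_; -_; 0#; 1#; refl; sym; trans; setoid; ring;
           +-cong; +-congˡ; +-identityʳ; -‿cong; -‿inverseˡ;
           *-cong; *-congˡ; *-congʳ; *-assoc; *-comm; *-identityˡ; *-identityʳ)
  open RingProperties ring using (x+x≈x⇒x≈0; +-inverseˡ-unique)
  open IntegerCoefficients R using (module Solver)
  open Solver using (solve; _:=_; _:+_; _:*_; :-_; con)
  open SetoidReasoning setoid

  -- `m` and `n` are the inverses of `a` and `b`; regroup `a * b * (m * n)`.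
  inverse-* : ∀ {a b m n} → a * b ≈ 1# → a * m ≈ 1# → b * n ≈ 1# → m * n ≈ 1#
  inverse-* {a} {b} {m} {n} ab am bn = begin
    m * n                ≈⟨ *-identityˡ _ ⟨
    1# * (m * n)         ≈⟨ *-congʳ ab ⟨
    a * b * (m * n)      ≈⟨ solve 4 (λ a b m n → a :* b :* (m :* n) := a :* m :* (b :* n)) refl a b m n ⟩
    a * m * (b * n)      ≈⟨ *-cong am bn ⟩
    1# * 1#              ≈⟨ *-identityˡ _ ⟩
    1#                   ∎

  quadratic : (a b y : Carrier) → Carrier
  quadratic a b y = 1# + a * y + b * (y * y)

  linear : (t y : Carrier) → Carrier
  linear t y = 1# + t * y

  quadratic-cong : ∀ {a a′ b b′ y} → a ≈ a′ → b ≈ b′ → quadratic a b y ≈ quadratic a′ b′ y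
  quadratic-cong a≈a′ b≈b′ = +-cong (+-congˡ (*-congʳ a≈a′)) (*-congʳ b≈b′)

  -- For y = - x / (1 + τ x).
  quadratic-flip : ∀ {α β τ x y} → y * linear τ x ≈ - x →
    quadratic α β y * (linear τ x * linear τ x) ≈ quadratic (τ + τ + - α) (τ * τ + - (α * τ) + β) x
  quadratic-flip {α} {β} {τ} {x} {y} ye≈-x = begin
    quadratic α β y * (e * e)
      -- Each `y` is paired with one factor `e`, so that every `y * e` can be replaced by `- x`.
      ≈⟨ solve 4 (λ α β y e → (con 1ℤ :+ α :* y :+ β :* (y :* y)) :* (e :* e)
                           := e :* e :+ α :* (y :* e) :* e :+ β :* (y :* e :* (y :* e))) refl α β y e ⟩
    e * e + α * (y * e) * e + β * (y * e * (y * e))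
      ≈⟨ +-cong (+-congˡ (*-congʳ (*-congˡ ye≈-x))) (*-congˡ (*-cong ye≈-x ye≈-x)) ⟩
    e * e + α * (- x) * e + β * (- x * - x)
      ≈⟨ solve 4 (λ α β τ x →
           let e = con 1ℤ :+ τ :* x
           in e :* e :+ α :* (:- x) :* e :+ β :* (:- x :* :- x)
           := con 1ℤ :+ (τ :+ τ :+ :- α) :* x :+ (τ :* τ :+ :- (α :* τ) :+ β) :* (x :* x)) refl α β τ x ⟩
    quadratic (τ + τ + - α) (τ * τ + - (α * τ) + β) x ∎
    where e = linear τ x

  -- Models power series under composition: X is x, and Null v says that v has zero constant
  -- term, so that v can be substituted.
  record IsSubstitution (X : Carrier) (Null : Carrier → Set p) (_∘_ : Op₂ Carrier) : Set (c ⊔ ℓ ⊔ p) where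
    field
      ∘-cong   : ∀ {a b v w} → a ≈ b → v ≈ w → a ∘ v ≈ b ∘ w
      +-∘      : ∀ a b v → (a + b) ∘ v ≈ a ∘ v + b ∘ v
      *-∘      : ∀ a b {v} → Null v → (a * b) ∘ v ≈ (a ∘ v) * (b ∘ v)
      1-∘      : ∀ {v} → Null v → 1# ∘ v ≈ 1#
      X-∘      : ∀ {v} → Null v → X ∘ v ≈ v
      ∘-X      : ∀ u → u ∘ X ≈ u
      ∘-assoc  : ∀ u {v w} → Null v → Null w → (u ∘ v) ∘ w ≈ u ∘ (v ∘ w)
      Null-X   : Null X
      Null-neg : ∀ {a} → Null a → Null (- a)
      Null-*   : ∀ {a} b → Null a → Null (a * b)
      Null-∘   : ∀ {v w} → Null v → Null w → Null (v ∘ w)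

    -- The abstract ring has no separate scalars; their role is taken by the elements that every
    -- admissible substitution fixes.
    Constant : Carrier → Set (c ⊔ ℓ ⊔ p)
    Constant a = ∀ {v} → Null v → a ∘ v ≈ a

    ∘-congˡ : ∀ {a v w} → v ≈ w → a ∘ v ≈ a ∘ w
    ∘-congˡ = ∘-cong refl

    ∘-congʳ : ∀ {a b v} → a ≈ b → a ∘ v ≈ b ∘ v
    ∘-congʳ a≈b = ∘-cong a≈b refl

    -- Additivity is enough: `0# ∘ v` equals its own double and so vanishes, which makes `(- a) ∘ v`
    -- an additive inverse of `a ∘ v`.
    -‿∘ : ∀ a v → (- a) ∘ v ≈ - (a ∘ v)
    -‿∘ a v = +-inverseˡ-unique _ _ (begin
      (- a) ∘ v + a ∘ v    ≈⟨ +-∘ _ _ _ ⟨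
      (- a + a) ∘ v        ≈⟨ ∘-congʳ (-‿inverseˡ a) ⟩
      0# ∘ v               ≈⟨ x+x≈x⇒x≈0 _ (trans (sym (+-∘ _ _ _)) (∘-congʳ (+-identityʳ _))) ⟩
      0#                   ∎)

    *≈1-∘ : ∀ {a b v} → Null v → a * b ≈ 1# → (a ∘ v) * (b ∘ v) ≈ 1#
    *≈1-∘ v₀ ab≈1 = trans (sym (*-∘ _ _ v₀)) (trans (∘-congʳ ab≈1) (1-∘ v₀))

    linear-∘ : ∀ {t v} → Constant t → Null v → linear t X ∘ v ≈ linear t v
    linear-∘ t-const v₀ = trans (+-∘ _ _ _)
      (+-cong (1-∘ v₀) (trans (*-∘ _ _ v₀) (*-cong (t-const v₀) (X-∘ v₀))))

    quadratic-∘ : ∀ {a b v} → Constant a → Constant b → Null v → quadratic a b X ∘ v ≈ quadratic a b v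
    quadratic-∘ a-const b-const v₀ = trans (+-∘ _ _ _) (+-cong (linear-∘ a-const v₀)
      (trans (*-∘ _ _ v₀) (*-cong (b-const v₀) (trans (*-∘ _ _ v₀) (*-cong (X-∘ v₀) (X-∘ v₀))))))

    -- A left inverse `f` and a right inverse `h` of `g` coincide. This makes the compositional
    -- inverse two-sided, although its construction only yields a right inverse.
    left-inverse : ∀ {f g h} → Null f → Null g → Null h → f ∘ g ≈ X → g ∘ h ≈ X → g ∘ f ≈ X
    left-inverse {f} {g} {h} f₀ g₀ h₀ fg gh = trans (∘-congˡ (begin
      f              ≈⟨ ∘-X f ⟨
      f ∘ X          ≈⟨ ∘-congˡ gh ⟨
      f ∘ (g ∘ h)    ≈⟨ ∘-assoc f g₀ h₀ ⟨
      (f ∘ g) ∘ h    ≈⟨ ∘-congʳ fg ⟩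
      X ∘ h          ≈⟨ X-∘ h₀ ⟩
      h              ∎)) gh

    -- The array (m , h ∘ f̄), with m = 1 / g(f̄) and h = f ∘ σ, squares to the identity.
    module Conjugation {f f̄ σ h g m}
      (f₀ : Null f) (f̄₀ : Null f̄) (σ₀ : Null σ) (h₀ : Null h)
      (f∘f̄ : f ∘ f̄ ≈ X) (f̄∘f : f̄ ∘ f ≈ X) (σ∘σ : σ ∘ σ ≈ X) (h≈f∘σ : h ≈ f ∘ σ)
      (g*g∘σ : g * (g ∘ σ) ≈ 1#) (g∘f̄*m : (g ∘ f̄) * m ≈ 1#) where

      private
        A₀ : Null (h ∘ f̄)
        A₀ = Null-∘ h₀ f̄₀

      -- As `h ∘ f̄` is the conjugate `f ∘ σ ∘ f̄`, the series `f̄` intertwines it with `σ`.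
      f̄∘A : f̄ ∘ (h ∘ f̄) ≈ σ ∘ f̄
      f̄∘A = begin
        f̄ ∘ (h ∘ f̄)          ≈⟨ ∘-congˡ (∘-congʳ h≈f∘σ) ⟩
        f̄ ∘ ((f ∘ σ) ∘ f̄)    ≈⟨ ∘-congˡ (∘-assoc f σ₀ f̄₀) ⟩
        f̄ ∘ (f ∘ (σ ∘ f̄))    ≈⟨ ∘-assoc f̄ f₀ (Null-∘ σ₀ f̄₀) ⟨
        (f̄ ∘ f) ∘ (σ ∘ f̄)    ≈⟨ ∘-congʳ f̄∘f ⟩
        X ∘ (σ ∘ f̄)          ≈⟨ X-∘ (Null-∘ σ₀ f̄₀) ⟩
        σ ∘ f̄                ∎

      involutive : (h ∘ f̄) ∘ (h ∘ f̄) ≈ X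
      involutive = begin
        (h ∘ f̄) ∘ (h ∘ f̄)      ≈⟨ ∘-assoc h f̄₀ A₀ ⟩
        h ∘ (f̄ ∘ (h ∘ f̄))      ≈⟨ ∘-cong h≈f∘σ f̄∘A ⟩
        (f ∘ σ) ∘ (σ ∘ f̄)      ≈⟨ ∘-assoc f σ₀ (Null-∘ σ₀ f̄₀) ⟩
        f ∘ (σ ∘ (σ ∘ f̄))      ≈⟨ ∘-congˡ (∘-assoc σ σ₀ f̄₀) ⟨
        f ∘ ((σ ∘ σ) ∘ f̄)      ≈⟨ ∘-congˡ (trans (∘-congʳ σ∘σ) (X-∘ f̄₀)) ⟩
        f ∘ f̄                  ≈⟨ f∘f̄ ⟩
        X                      ∎

      -- Substituting `f̄` into `g*g∘σ` and applying `f̄∘A` shows that `g ∘ f̄` and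
      -- `(g ∘ f̄) ∘ (h ∘ f̄)` have product `1#`. Their inverses are `m` and `m ∘ (h ∘ f̄)`, so
      -- `inverse-*` applies.
      multiplier : m * (m ∘ (h ∘ f̄)) ≈ 1#
      multiplier = inverse-* (*≈1-∘ f̄₀ g*g∘σ) g∘f̄*m (trans (*-congʳ (begin
        (g ∘ σ) ∘ f̄            ≈⟨ ∘-assoc g σ₀ f̄₀ ⟩
        g ∘ (σ ∘ f̄)            ≈⟨ ∘-congˡ f̄∘A ⟨
        g ∘ (f̄ ∘ (h ∘ f̄))      ≈⟨ ∘-assoc g f̄₀ A₀ ⟨
        (g ∘ f̄) ∘ (h ∘ f̄)      ∎)) (*≈1-∘ A₀ g∘f̄*m))

    -- Since quadratic-flip is an involution on the coefficients (α , β), it exchanges D and N.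
    module Flip {α β α′ β′ τ} (α-const : Constant α) (β-const : Constant β)
      (α′-const : Constant α′) (β′-const : Constant β′) (τ-const : Constant τ)
      (α′≈ : α′ ≈ τ + τ + - α) (β′≈ : β′ ≈ τ * τ + - (α * τ) + β) {D N e D⁻¹ N⁻¹ e⁻¹}
      (D≈ : D ≈ quadratic α β X) (N≈ : N ≈ quadratic α′ β′ X) (e≈ : e ≈ linear τ X)
      (D*D⁻¹ : D * D⁻¹ ≈ 1#) (N*N⁻¹ : N * N⁻¹ ≈ 1#) (e*e⁻¹ : e * e⁻¹ ≈ 1#) where

      σ : Carrier
      σ = - X * e⁻¹

      σ₀ : Null σ
      σ₀ = Null-* e⁻¹ (Null-neg Null-X)

      private
        σe≈-X : σ * e ≈ - X
        σe≈-X = trans (*-assoc _ _ _)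
          (trans (*-congˡ (trans (*-comm _ _) e*e⁻¹)) (*-identityʳ _))

        σ*linear≈-X : σ * linear τ X ≈ - X
        σ*linear≈-X = trans (*-congˡ (sym e≈)) σe≈-X

        quadratic∘σ*e² : ∀ {a b Q} → Constant a → Constant b → Q ≈ quadratic a b X →
          (Q ∘ σ) * (e * e) ≈ quadratic (τ + τ + - a) (τ * τ + - (a * τ) + b) X
        quadratic∘σ*e² a-const b-const Q≈ = trans
          (*-cong (trans (∘-congʳ Q≈) (quadratic-∘ a-const b-const σ₀)) (*-cong e≈ e≈))
          (quadratic-flip σ*linear≈-X)

        D∘σ*e² : (D ∘ σ) * (e * e) ≈ N
        D∘σ*e² = begin
          (D ∘ σ) * (e * e)               ≈⟨ quadratic∘σ*e² α-const β-const D≈ ⟩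
          quadratic (τ + τ + - α) (τ * τ + - (α * τ) + β) X ≈⟨ quadratic-cong α′≈ β′≈ ⟨
          quadratic α′ β′ X               ≈⟨ N≈ ⟨
          N                               ∎

        N∘σ*e² : (N ∘ σ) * (e * e) ≈ D
        N∘σ*e² = begin
          (N ∘ σ) * (e * e)               ≈⟨ quadratic∘σ*e² α′-const β′-const N≈ ⟩
          quadratic (τ + τ + - α′) (τ * τ + - (α′ * τ) + β′) X
            ≈⟨ quadratic-cong (+-congˡ (-‿cong α′≈)) (+-cong (+-congˡ (-‿cong (*-congʳ α′≈))) β′≈) ⟩
          quadratic (τ + τ + - (τ + τ + - α)) (τ * τ + - ((τ + τ + - α) * τ) + (τ * τ + - (α * τ) + β)) X
            ≈⟨ quadratic-cong
                 (solve 2 (λ α τ → τ :+ τ :+ :- (τ :+ τ :+ :- α) := α) refl α τ)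
                 (solve 3 (λ α β τ → τ :* τ :+ :- ((τ :+ τ :+ :- α) :* τ) :+ (τ :* τ :+ :- (α :* τ) :+ β) := β)
                          refl α β τ) ⟩
          quadratic α β X                 ≈⟨ D≈ ⟨
          D                               ∎

      -- In fractions, 1 - τx / (1 + τx) = 1 / (1 + τx).
      e∘σ : e ∘ σ ≈ e⁻¹
      e∘σ = begin
        e ∘ σ                                 ≈⟨ trans (∘-congʳ e≈) (linear-∘ τ-const σ₀) ⟩
        linear τ σ                            ≈⟨ *-identityʳ _ ⟨
        linear τ σ * 1#                       ≈⟨ *-congˡ e*e⁻¹ ⟨
        linear τ σ * (e * e⁻¹)                ≈⟨ solve 4 (λ τ σ e e⁻¹ → (con 1ℤ :+ τ :* σ) :* (e :* e⁻¹)
                                                   := (e :+ τ :* (σ :* e)) :* e⁻¹) refl τ σ e e⁻¹ ⟩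
        (e + τ * (σ * e)) * e⁻¹               ≈⟨ *-congʳ (+-cong e≈ (*-congˡ σe≈-X)) ⟩
        (linear τ X + τ * - X) * e⁻¹          ≈⟨ *-congʳ (solve 2 (λ τ x → con 1ℤ :+ τ :* x :+ τ :* :- x := con 1ℤ)
                                                   refl τ X) ⟩
        1# * e⁻¹                              ≈⟨ *-identityˡ _ ⟩
        e⁻¹                                   ∎

      -- Substituting `σ` into `σ * e ≈ - X` gives `(σ ∘ σ) * e⁻¹ ≈ - σ` by `e∘σ`; multiplying by
      -- `e` then leaves `- (σ * e)`, which is `X`.
      σ∘σ : σ ∘ σ ≈ X
      σ∘σ = begin
        σ ∘ σ                          ≈⟨ *-identityʳ _ ⟨
        (σ ∘ σ) * 1#                   ≈⟨ *-congˡ e*e⁻¹ ⟨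
        (σ ∘ σ) * (e * e⁻¹)            ≈⟨ solve 3 (λ s e e⁻¹ → s :* (e :* e⁻¹) := s :* e⁻¹ :* e) refl (σ ∘ σ) e e⁻¹ ⟩
        (σ ∘ σ) * e⁻¹ * e              ≈⟨ *-congʳ (*-congˡ e∘σ) ⟨
        (σ ∘ σ) * (e ∘ σ) * e          ≈⟨ *-congʳ (*-∘ σ e σ₀) ⟨
        ((σ * e) ∘ σ) * e              ≈⟨ *-congʳ (trans (∘-congʳ σe≈-X) (trans (-‿∘ X σ) (-‿cong (X-∘ σ₀)))) ⟩
        - σ * e                        ≈⟨ solve 2 (λ s e → :- s :* e := :- (s :* e)) refl σ e ⟩
        - (σ * e)                      ≈⟨ -‿cong σe≈-X ⟩
        - - X                          ≈⟨ solve 1 (λ x → :- :- x := x) refl X ⟩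
        X                              ∎

      -- In fractions, f(σ) = σ / D(σ) = σe² / N, and σe = -x turns this into -xe / N.
      h≈f∘σ : - (X * e) * N⁻¹ ≈ (X * D⁻¹) ∘ σ
      h≈f∘σ = begin
        - (X * e) * N⁻¹
          ≈⟨ solve 3 (λ x e n → :- (x :* e) :* n := :- x :* e :* n) refl X e N⁻¹ ⟩
        - X * e * N⁻¹
          ≈⟨ *-congʳ (*-congʳ σe≈-X) ⟨
        σ * e * e * N⁻¹
          ≈⟨ *-identityʳ _ ⟨
        σ * e * e * N⁻¹ * 1#
          ≈⟨ *-congˡ (*≈1-∘ σ₀ D*D⁻¹) ⟨
        σ * e * e * N⁻¹ * ((D ∘ σ) * (D⁻¹ ∘ σ))
          ≈⟨ solve 5 (λ s e n d d⁻¹ → s :* e :* e :* n :* (d :* d⁻¹) := s :* d⁻¹ :* (d :* (e :* e) :* n))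
                   refl σ e N⁻¹ (D ∘ σ) (D⁻¹ ∘ σ) ⟩
        σ * (D⁻¹ ∘ σ) * ((D ∘ σ) * (e * e) * N⁻¹)
          ≈⟨ *-congˡ (trans (*-congʳ D∘σ*e²) N*N⁻¹) ⟩
        σ * (D⁻¹ ∘ σ) * 1#
          ≈⟨ *-identityʳ _ ⟩
        σ * (D⁻¹ ∘ σ)
          ≈⟨ *-congʳ (X-∘ σ₀) ⟨
        (X ∘ σ) * (D⁻¹ ∘ σ)
          ≈⟨ *-∘ _ _ σ₀ ⟨
        (X * D⁻¹) ∘ σ ∎

      -- In fractions, g(σ) = N(σ) / D(σ) = D / N, since the factors e² cancel. The proof moves e²
      -- from `D ∘ σ` to `N ∘ σ`.
      g*g∘σ : N * D⁻¹ * ((N * D⁻¹) ∘ σ) ≈ 1#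
      g*g∘σ = begin
        N * D⁻¹ * ((N * D⁻¹) ∘ σ)
          ≈⟨ *-cong (*-congʳ (sym D∘σ*e²)) (*-∘ _ _ σ₀) ⟩
        (D ∘ σ) * (e * e) * D⁻¹ * ((N ∘ σ) * (D⁻¹ ∘ σ))
          ≈⟨ solve 5 (λ e dσ d⁻¹ nσ d⁻¹σ → dσ :* (e :* e) :* d⁻¹ :* (nσ :* d⁻¹σ)
                       := nσ :* (e :* e) :* d⁻¹ :* (dσ :* d⁻¹σ))
                   refl e (D ∘ σ) D⁻¹ (N ∘ σ) (D⁻¹ ∘ σ) ⟩
        (N ∘ σ) * (e * e) * D⁻¹ * ((D ∘ σ) * (D⁻¹ ∘ σ))
          ≈⟨ *-cong (trans (*-congʳ N∘σ*e²) D*D⁻¹) (*≈1-∘ σ₀ D*D⁻¹) ⟩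
        1# * 1#
          ≈⟨ *-identityˡ _ ⟩
        1# ∎

-- The ring of formal power series and the laws of composition.

module SeriesRing {c ℓ₁ ℓ₂} (k : HeytingField c ℓ₁ ℓ₂) where

  open Riordan k
  open HeytingCommutativeRing (HeytingField.heytingCommutativeRing k) using () renaming (commutativeRing to fieldRing)
  open CommutativeRing fieldRing
    using (Carrier; _≈_; _+_; _*_; -_; 0#; 1#; refl; sym; trans; setoid; semiring; ring;
           +-cong; +-congˡ; +-congʳ; +-assoc; +-comm; +-identityˡ; +-identityʳ; -‿cong; -‿inverseˡ; -‿inverseʳ;
           *-cong; *-congˡ; *-congʳ; *-assoc; *-identityʳ; zeroˡ; zeroʳ; distribˡ; distribʳ)
  open RingProperties ring using (-0#≈0#)
  open SemiringSum semiring using (sum-syntax; sum-cong-≋; ∑-distrib-+; *-distribˡ-sum)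

  infixl 6 _+ˢ_
  _+ˢ_ : Series → Series → Series
  (a +ˢ b) n = a n + b n

  const : Carrier → Series
  const x zero    = x
  const x (suc _) = 0#

  tail : Series → Series
  tail a n = a (suc n)

  infixr 7 _·ˢ_
  _·ˢ_ : Carrier → Series → Series
  (x ·ˢ a) n = x * a n

  *ˢ-cong : ∀ {a a′ b b′} → a ≈ˢ a′ → b ≈ˢ b′ → a *ˢ b ≈ˢ a′ *ˢ b′
  *ˢ-cong p q n = sum-cong-≋ {suc n} λ i → *-cong (p (toℕ i)) (q (n ∸ toℕ i))

  *ˢ-distribʳ : ∀ a b d → (b +ˢ d) *ˢ a ≈ˢ b *ˢ a +ˢ d *ˢ a
  *ˢ-distribʳ a b d n = trans (sum-cong-≋ {suc n} λ i → distribʳ (a (n ∸ toℕ i)) (b (toℕ i)) (d (toℕ i)))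
    (∑-distrib-+ {suc n} (λ i → b (toℕ i) * a (n ∸ toℕ i)) (λ i → d (toℕ i) * a (n ∸ toℕ i)))

  *ˢ-distribˡ : ∀ a b d → a *ˢ (b +ˢ d) ≈ˢ a *ˢ b +ˢ a *ˢ d
  *ˢ-distribˡ a b d n = trans (*ˢ-comm a (b +ˢ d) n)
    (trans (*ˢ-distribʳ a b d n) (+-cong (*ˢ-comm b a n) (*ˢ-comm d a n)))

  ·ˢ-*ˢ : ∀ x a b → (x ·ˢ a) *ˢ b ≈ˢ x ·ˢ (a *ˢ b)
  ·ˢ-*ˢ x a b n = trans (sum-cong-≋ {suc n} λ i → *-assoc x (a (toℕ i)) (b (n ∸ toℕ i)))
    (sym (*-distribˡ-sum {suc n} x (λ i → a (toℕ i) * b (n ∸ toℕ i))))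

  -- Induction on the degree, for all `a` at once. The convolution unfolds so that `tail (a *ˢ b)`
  -- is by computation `a 0 ·ˢ tail b +ˢ tail a *ˢ b`.
  *ˢ-assoc : ∀ a b d → (a *ˢ b) *ˢ d ≈ˢ a *ˢ (b *ˢ d)
  *ˢ-assoc a b d zero = begin
    (a *ˢ b) 0 * d 0 + 0#      ≈⟨ +-congʳ (trans (*-congʳ (*ˢ-0 a b)) (*-assoc _ _ _)) ⟩
    a 0 * (b 0 * d 0) + 0#     ≈⟨ +-congʳ (*-congˡ (*ˢ-0 b d)) ⟨
    a 0 * (b *ˢ d) 0 + 0#      ∎
    where open SetoidReasoning setoid
  *ˢ-assoc a b d (suc n) = begin
    (a *ˢ b) 0 * d (suc n) + (tail (a *ˢ b) *ˢ d) n
      ≈⟨ +-cong (trans (*-congʳ (*ˢ-0 a b)) (*-assoc _ _ _)) (*ˢ-distribʳ d (a 0 ·ˢ tail b) (tail a *ˢ b) n) ⟩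
    a 0 * (b 0 * d (suc n)) + (((a 0 ·ˢ tail b) *ˢ d) n + ((tail a *ˢ b) *ˢ d) n)
      ≈⟨ +-congˡ (+-cong (·ˢ-*ˢ (a 0) (tail b) d n) (*ˢ-assoc (tail a) b d n)) ⟩
    a 0 * (b 0 * d (suc n)) + (a 0 * (tail b *ˢ d) n + (tail a *ˢ (b *ˢ d)) n)
      ≈⟨ +-assoc _ _ _ ⟨
    a 0 * (b 0 * d (suc n)) + a 0 * (tail b *ˢ d) n + (tail a *ˢ (b *ˢ d)) n
      ≈⟨ +-congʳ (distribˡ _ _ _) ⟨
    a 0 * (b *ˢ d) (suc n) + (tail a *ˢ (b *ˢ d)) n ∎
    where open SetoidReasoning setoid

  seriesRing : CommutativeRing c ℓ₁
  seriesRing = record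
    { Carrier = Series
    ; _≈_ = _≈ˢ_
    ; _+_ = _+ˢ_
    ; _*_ = _*ˢ_
    ; -_ = -ˢ_
    ; 0# = 0ˢ
    ; 1# = 1ˢ
    ; isCommutativeRing = record
      { isRing = record
        { +-isAbelianGroup = record
          { isGroup = record
            { isMonoid = record
              { isSemigroup = record
                { isMagma = record
                  { isEquivalence = record
                    { refl = λ _ → refl ; sym = λ p n → sym (p n) ; trans = λ p q n → trans (p n) (q n) }
                  ; ∙-cong = λ p q n → +-cong (p n) (q n)
                  }
                ; assoc = λ _ _ _ _ → +-assoc _ _ _
                }
              ; identity = (λ _ _ → +-identityˡ _) , (λ _ _ → +-identityʳ _)
              }
            ; inverse = (λ _ _ → -‿inverseˡ _) , (λ _ _ → -‿inverseʳ _)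
            ; ⁻¹-cong = λ p n → -‿cong (p n)
            }
          ; comm = λ _ _ _ → +-comm _ _
          }
        ; *-cong = *ˢ-cong
        ; *-assoc = *ˢ-assoc
        ; *-identity = (λ a n → trans (*ˢ-comm 1ˢ a n) (*ˢ-identityʳ a n)) , *ˢ-identityʳ
        ; distrib = *ˢ-distribˡ , *ˢ-distribʳ
        }
      ; *-comm = *ˢ-comm
      }
    }

  module S where
    open CommutativeRing seriesRing public
    open IntegerCoefficients seriesRing public using (module Solver)
    open Solver public using (solve; _:=_; _:+_; _:*_)

  const-* : ∀ x a → const x *ˢ a ≈ˢ x ·ˢ a
  const-* x a n = begin
    (const x *ˢ a) n          ≈⟨ S.*-cong {const x} {x ·ˢ 1ˢ} {a} {a} const≈ S.refl n ⟩
    ((x ·ˢ 1ˢ) *ˢ a) n        ≈⟨ ·ˢ-*ˢ x 1ˢ a n ⟩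
    x * (1ˢ *ˢ a) n           ≈⟨ *-congˡ (S.*-identityˡ a n) ⟩
    x * a n                   ∎
    where
    open SetoidReasoning setoid
    const≈ : const x ≈ˢ x ·ˢ 1ˢ
    const≈ zero    = sym (*-identityʳ x)
    const≈ (suc _) = sym (zeroʳ x)

  x*ˢ : ∀ a → xˢ *ˢ a ≈ˢ shift a
  x*ˢ a zero    = trans (*ˢ-0 xˢ a) (zeroˡ _)
  x*ˢ a (suc n) = trans (+-vanishˡ (zeroˡ _)) (S.*-identityˡ a n)

  const+shift : ∀ a → a ≈ˢ const (a 0) +ˢ xˢ *ˢ tail a
  const+shift a zero    = sym (+-vanishʳ (x*ˢ (tail a) 0))
  const+shift a (suc n) = sym (trans (+-identityˡ _) (x*ˢ (tail a) (suc n)))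

  const-+ : ∀ x y → const (x + y) ≈ˢ const x +ˢ const y
  const-+ x y zero    = refl
  const-+ x y (suc _) = sym (+-identityˡ _)

  const-*-const : ∀ x y → const (x * y) ≈ˢ const x *ˢ const y
  const-*-const x y n = trans (lemma n) (sym (const-* x (const y) n))
    where
    lemma : const (x * y) ≈ˢ x ·ˢ const y
    lemma zero    = refl
    lemma (suc _) = sym (zeroʳ x)

  const-neg : ∀ x → const (- x) ≈ˢ -ˢ const x
  const-neg x zero    = refl
  const-neg x (suc _) = sym -0#≈0#

  const-cong : ∀ {x y} → x ≈ y → const x ≈ˢ const y
  const-cong x≈y zero    = x≈y
  const-cong x≈y (suc _) = refl

  -- Multiplication by `v` gains one degree: as `v 0` vanishes, the coefficient of degree m + 1 of
  -- the product only involves the other factor up to degree m.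
  agree-suc : ∀ {n v a b} → v 0 ≈ 0# → Agree n a b → Agree (suc n) (v *ˢ a) (v *ˢ b)
  agree-suc {v = v} {a} {b} v₀ p {zero} _ =
    trans (*ˢ-0 v a) (trans (*-vanishˡ v₀) (sym (trans (*ˢ-0 v b) (*-vanishˡ v₀))))
  agree-suc {n} {v} {a} {b} v₀ p {suc m} (s≤s m<n) = begin
    v 0 * a (suc m) + (tail v *ˢ a) m   ≈⟨ +-vanishˡ (*-vanishˡ v₀) ⟩
    (tail v *ˢ a) m                     ≈⟨ *ˢ-agree {n} {tail v} {tail v} {a} {b} (λ _ → refl) p m<n ⟩
    (tail v *ˢ b) m                     ≈⟨ +-vanishˡ (*-vanishˡ v₀) ⟨
    v 0 * b (suc m) + (tail v *ˢ b) m   ∎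
    where open SetoidReasoning setoid

  agree-step : ∀ {n v d a b} → v 0 ≈ 0# → Agree n a b → Agree (suc n) (d +ˢ v *ˢ a) (d +ˢ v *ˢ b)
  agree-step {v = v} {a = a} {b} v₀ p m<1+n = +-congˡ (agree-suc {v = v} {a} {b} v₀ p m<1+n)

  -- As v has zero constant term, the first n coefficients of F (tail u) determine the first
  -- n + 1 of F u.  Laws of composition follow by showing that both sides obey one recursion.
  recursion-unique : ∀ (K : Carrier → Series) {v} → v 0 ≈ 0# → ∀ {F G : Series → Series} →
    (∀ u → F u ≈ˢ K (u 0) +ˢ v *ˢ F (tail u)) →
    (∀ u → G u ≈ˢ K (u 0) +ˢ v *ˢ G (tail u)) → ∀ u → F u ≈ˢ G u
  recursion-unique K {v} v₀ {F} {G} F-rec G-rec u n = agree (suc n) u ℕ.≤-refl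
    where
    agree : ∀ n u → Agree n (F u) (G u)
    agree (suc n) u {m} m<1+n = trans (F-rec u m)
      (trans (agree-step {v = v} {K (u 0)} {F (tail u)} {G (tail u)} v₀ (agree n (tail u)) m<1+n)
             (sym (G-rec u m)))

  -- The composite with `u` cut off after `n` coefficients. The length is a parameter of its own,
  -- whereas in `_∘ˢ_` it is tied to the coefficient being read, which blocks a direct induction.
  horner : ℕ → Series → Series → Series
  horner zero    u v = 0ˢ
  horner (suc n) u v = const (u 0) +ˢ v *ˢ horner n (tail u) v

  horner-agree : ∀ {v} → v 0 ≈ 0# → ∀ {n i j} → n ≤ i → n ≤ j → ∀ u → Agree n (horner i u v) (horner j u v)
  horner-agree {v} v₀ {suc n} {suc i} {suc j} (s≤s n≤i) (s≤s n≤j) u =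
    agree-step {v = v} {const (u 0)} {horner i (tail u) v} {horner j (tail u) v} v₀
      (horner-agree v₀ n≤i n≤j (tail u))

  -- The factor d absorbs one power of v at each step of the induction.
  sum≈horner : ∀ i u v d n → ∑[ j < i ] (u (toℕ j) * (d *ˢ v ^ˢ toℕ j) n) ≈ (d *ˢ horner i u v) n
  sum≈horner zero    u v d n = sym (S.zeroʳ d n)
  sum≈horner (suc i) u v d n = begin
    u 0 * (d *ˢ 1ˢ) n + ∑[ j < i ] (u (suc (toℕ j)) * (d *ˢ (v *ˢ v ^ˢ toℕ j)) n)
      ≈⟨ +-cong (*-congˡ (*ˢ-identityʳ d n))
                (sum-cong-≋ {i} λ j → *-congˡ (sym (*ˢ-assoc d v (v ^ˢ toℕ j) n))) ⟩
    u 0 * d n + ∑[ j < i ] (tail u (toℕ j) * ((d *ˢ v) *ˢ v ^ˢ toℕ j) n)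
      ≈⟨ +-cong (sym (const-* (u 0) d n)) (sum≈horner i (tail u) v (d *ˢ v) n) ⟩
    (const (u 0) *ˢ d) n + ((d *ˢ v) *ˢ horner i (tail u) v) n
      ≈⟨ S.solve 4 (λ k d v h → k S.:* d S.:+ d S.:* v S.:* h S.:= d S.:* (k S.:+ v S.:* h))
           S.refl (const (u 0)) d v (horner i (tail u) v) n ⟩
    (d *ˢ horner (suc i) u v) n ∎
    where open SetoidReasoning setoid

  ∘ˢ≈horner : ∀ u v n → (u ∘ˢ v) n ≈ horner (suc n) u v n
  ∘ˢ≈horner u v n = begin
    (u ∘ˢ v) n
      -- The factor `1ˢ` is the initial value of `d` in `sum≈horner`.
      ≈⟨ sum-cong-≋ {suc n} (λ j → *-congˡ {u (toℕ j)} (sym (S.*-identityˡ (v ^ˢ toℕ j) n))) ⟩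
    ∑[ j < suc n ] (u (toℕ j) * (1ˢ *ˢ v ^ˢ toℕ j) n)
      ≈⟨ sum≈horner (suc n) u v 1ˢ n ⟩
    (1ˢ *ˢ horner (suc n) u v) n
      ≈⟨ S.*-identityˡ (horner (suc n) u v) n ⟩
    horner (suc n) u v n ∎
    where open SetoidReasoning setoid

  -- One Horner step is peeled off. The remaining length `n` suffices: below degree `n` it gives the
  -- coefficients of `tail u ∘ˢ v`, and multiplication by `v` makes up for the missing degree.
  ∘ˢ-rec : ∀ {v} → v 0 ≈ 0# → ∀ u → u ∘ˢ v ≈ˢ const (u 0) +ˢ v *ˢ (tail u ∘ˢ v)
  ∘ˢ-rec {v} v₀ u n = trans (∘ˢ≈horner u v n)
    (agree-step {v = v} {const (u 0)} {horner n (tail u) v} {tail u ∘ˢ v} v₀ agree ℕ.≤-refl)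
    where
    agree : Agree n (horner n (tail u) v) (tail u ∘ˢ v)
    agree {m} m<n = trans (horner-agree v₀ m<n ℕ.≤-refl (tail u) ℕ.≤-refl) (sym (∘ˢ≈horner (tail u) v m))

  ^ˢ-cong : ∀ {a b} → a ≈ˢ b → ∀ j → a ^ˢ j ≈ˢ b ^ˢ j
  ^ˢ-cong p zero    _ = refl
  ^ˢ-cong p (suc j)   = *ˢ-cong p (^ˢ-cong p j)

  ∘ˢ-cong : ∀ {a b v w} → a ≈ˢ b → v ≈ˢ w → a ∘ˢ v ≈ˢ b ∘ˢ w
  ∘ˢ-cong p q n = sum-cong-≋ {suc n} λ j → *-cong (p (toℕ j)) (^ˢ-cong q (toℕ j) n)

  +ˢ-∘ˢ : ∀ a b v → (a +ˢ b) ∘ˢ v ≈ˢ a ∘ˢ v +ˢ b ∘ˢ v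
  +ˢ-∘ˢ a b v n = trans (sum-cong-≋ {suc n} λ j → distribʳ ((v ^ˢ toℕ j) n) (a (toℕ j)) (b (toℕ j)))
    (∑-distrib-+ {suc n} (λ j → a (toℕ j) * (v ^ˢ toℕ j) n) (λ j → b (toℕ j) * (v ^ˢ toℕ j) n))

  ·ˢ-∘ˢ : ∀ x a v → (x ·ˢ a) ∘ˢ v ≈ˢ x ·ˢ (a ∘ˢ v)
  ·ˢ-∘ˢ x a v n = trans (sum-cong-≋ {suc n} λ j → *-assoc x (a (toℕ j)) ((v ^ˢ toℕ j) n))
    (sym (*-distribˡ-sum {suc n} x (λ j → a (toℕ j) * (v ^ˢ toℕ j) n)))

  0ˢ-∘ˢ : ∀ v → 0ˢ ∘ˢ v ≈ˢ 0ˢ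
  0ˢ-∘ˢ v = RingProperties.x+x≈x⇒x≈0 S.ring (0ˢ ∘ˢ v) λ n →
    trans (sym (+ˢ-∘ˢ 0ˢ 0ˢ v n)) (∘ˢ-cong {0ˢ +ˢ 0ˢ} {0ˢ} {v} (λ _ → +-identityʳ _) S.refl n)

  const-∘ˢ : ∀ x {v} → v 0 ≈ 0# → const x ∘ˢ v ≈ˢ const x
  const-∘ˢ x {v} v₀ n = trans (∘ˢ-rec v₀ (const x) n)
    (+-vanishʳ (trans (*ˢ-cong {v} S.refl (0ˢ-∘ˢ v) n) (S.zeroʳ v n)))

  1≈const : 1ˢ ≈ˢ const 1#
  1≈const zero    = refl
  1≈const (suc _) = refl

  1ˢ-∘ˢ : ∀ {v} → v 0 ≈ 0# → 1ˢ ∘ˢ v ≈ˢ 1ˢ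
  1ˢ-∘ˢ {v} v₀ n = trans (∘ˢ-cong {v = v} 1≈const S.refl n)
    (trans (const-∘ˢ 1# v₀ n) (sym (1≈const n)))

  xˢ-∘ˢ : ∀ {v} → v 0 ≈ 0# → xˢ ∘ˢ v ≈ˢ v
  xˢ-∘ˢ {v} v₀ n = begin
    (xˢ ∘ˢ v) n                          ≈⟨ ∘ˢ-rec v₀ xˢ n ⟩
    const 0# n + (v *ˢ (1ˢ ∘ˢ v)) n      ≈⟨ +-vanishˡ (const0 n) ⟩
    (v *ˢ (1ˢ ∘ˢ v)) n                   ≈⟨ *ˢ-cong {v} S.refl (1ˢ-∘ˢ v₀) n ⟩
    (v *ˢ 1ˢ) n                          ≈⟨ *ˢ-identityʳ v n ⟩
    v n                                  ∎
    where
    open SetoidReasoning setoid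
    const0 : const 0# ≈ˢ 0ˢ
    const0 zero    = refl
    const0 (suc _) = refl

  -- By `const+shift`, the identity map on series obeys the recursion of composition with `xˢ`.
  ∘ˢ-xˢ : ∀ u → u ∘ˢ xˢ ≈ˢ u
  ∘ˢ-xˢ = recursion-unique const {xˢ} refl (∘ˢ-rec refl) const+shift

  -- With `b` fixed, both sides as functions of `a` obey the recursion whose first term is
  -- `const (a 0) *ˢ (b ∘ˢ v)`.
  *ˢ-∘ˢ : ∀ a b {v} → v 0 ≈ 0# → (a *ˢ b) ∘ˢ v ≈ˢ (a ∘ˢ v) *ˢ (b ∘ˢ v)
  *ˢ-∘ˢ a b {v} v₀ = recursion-unique (λ x → const x *ˢ (b ∘ˢ v)) {v} v₀ {λ a → (a *ˢ b) ∘ˢ v} F-rec G-rec a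
    where
    open SetoidReasoning setoid
    F-rec : ∀ a → (a *ˢ b) ∘ˢ v ≈ˢ const (a 0) *ˢ (b ∘ˢ v) +ˢ v *ˢ ((tail a *ˢ b) ∘ˢ v)
    F-rec a n = begin
      ((a *ˢ b) ∘ˢ v) n
        ≈⟨ ∘ˢ-rec v₀ (a *ˢ b) n ⟩
      (const ((a *ˢ b) 0) +ˢ v *ˢ (tail (a *ˢ b) ∘ˢ v)) n
        -- The tail of the product splits as in `*ˢ-assoc`; its part with `tail b` later recombines
        -- with `const (b 0)` into `b ∘ˢ v`.
        ≈⟨ S.+-cong {const ((a *ˢ b) 0)} {const (a 0) *ˢ const (b 0)} {v *ˢ (tail (a *ˢ b) ∘ˢ v)}
             {v *ˢ (const (a 0) *ˢ (tail b ∘ˢ v) +ˢ (tail a *ˢ b) ∘ˢ v)}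
             (S.trans (const-cong (*ˢ-0 a b)) (const-*-const (a 0) (b 0)))
             (*ˢ-cong {v} S.refl λ m → trans (+ˢ-∘ˢ (a 0 ·ˢ tail b) (tail a *ˢ b) v m)
               (+-congʳ (trans (·ˢ-∘ˢ (a 0) (tail b) v m) (sym (const-* (a 0) (tail b ∘ˢ v) m))))) n ⟩
      (const (a 0) *ˢ const (b 0) +ˢ v *ˢ (const (a 0) *ˢ (tail b ∘ˢ v) +ˢ (tail a *ˢ b) ∘ˢ v)) n
        ≈⟨ S.solve 5 (λ k l v b ab → k S.:* l S.:+ v S.:* (k S.:* b S.:+ ab)
                                 S.:= k S.:* (l S.:+ v S.:* b) S.:+ v S.:* ab)
             S.refl (const (a 0)) (const (b 0)) v (tail b ∘ˢ v) ((tail a *ˢ b) ∘ˢ v) n ⟩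
      (const (a 0) *ˢ (const (b 0) +ˢ v *ˢ (tail b ∘ˢ v)) +ˢ v *ˢ ((tail a *ˢ b) ∘ˢ v)) n
        ≈⟨ +-congʳ (*ˢ-cong {const (a 0)} S.refl (∘ˢ-rec v₀ b) n) ⟨
      (const (a 0) *ˢ (b ∘ˢ v) +ˢ v *ˢ ((tail a *ˢ b) ∘ˢ v)) n ∎

    G-rec : ∀ a → (a ∘ˢ v) *ˢ (b ∘ˢ v) ≈ˢ const (a 0) *ˢ (b ∘ˢ v) +ˢ v *ˢ ((tail a ∘ˢ v) *ˢ (b ∘ˢ v))
    G-rec a n = begin
      ((a ∘ˢ v) *ˢ (b ∘ˢ v)) n
        ≈⟨ *ˢ-cong {b = b ∘ˢ v} (∘ˢ-rec v₀ a) S.refl n ⟩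
      ((const (a 0) +ˢ v *ˢ (tail a ∘ˢ v)) *ˢ (b ∘ˢ v)) n
        ≈⟨ S.solve 4 (λ k v a b → (k S.:+ v S.:* a) S.:* b S.:= k S.:* b S.:+ v S.:* (a S.:* b))
             S.refl (const (a 0)) v (tail a ∘ˢ v) (b ∘ˢ v) n ⟩
      (const (a 0) *ˢ (b ∘ˢ v) +ˢ v *ˢ ((tail a ∘ˢ v) *ˢ (b ∘ˢ v))) n ∎

  -- Both sides obey the recursion in `u` along `v ∘ˢ w`; on the left this uses that substituting
  -- `w` is multiplicative.
  ∘ˢ-assoc : ∀ u {v w} → v 0 ≈ 0# → w 0 ≈ 0# → (u ∘ˢ v) ∘ˢ w ≈ˢ u ∘ˢ (v ∘ˢ w)
  ∘ˢ-assoc u {v} {w} v₀ w₀ = recursion-unique const {v ∘ˢ w} v∘w₀ {λ u → (u ∘ˢ v) ∘ˢ w} rec (∘ˢ-rec v∘w₀) u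
    where
    open SetoidReasoning setoid
    v∘w₀ : (v ∘ˢ w) 0 ≈ 0#
    v∘w₀ = trans (∘ˢ-0 v w) v₀

    rec : ∀ u → (u ∘ˢ v) ∘ˢ w ≈ˢ const (u 0) +ˢ (v ∘ˢ w) *ˢ ((tail u ∘ˢ v) ∘ˢ w)
    rec u n = begin
      ((u ∘ˢ v) ∘ˢ w) n
        ≈⟨ ∘ˢ-cong {v = w} (∘ˢ-rec v₀ u) S.refl n ⟩
      ((const (u 0) +ˢ v *ˢ (tail u ∘ˢ v)) ∘ˢ w) n
        ≈⟨ +ˢ-∘ˢ (const (u 0)) (v *ˢ (tail u ∘ˢ v)) w n ⟩
      (const (u 0) ∘ˢ w) n + ((v *ˢ (tail u ∘ˢ v)) ∘ˢ w) n
        ≈⟨ +-cong (const-∘ˢ (u 0) w₀ n) (*ˢ-∘ˢ v (tail u ∘ˢ v) w₀ n) ⟩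
      (const (u 0) +ˢ (v ∘ˢ w) *ˢ ((tail u ∘ˢ v) ∘ˢ w)) n ∎

  open Substitution {p = ℓ₁} seriesRing

  isSubstitution : IsSubstitution xˢ (λ a → a 0 ≈ 0#) _∘ˢ_
  isSubstitution = record
    { ∘-cong   = ∘ˢ-cong
    ; +-∘      = +ˢ-∘ˢ
    ; *-∘      = *ˢ-∘ˢ
    ; 1-∘      = 1ˢ-∘ˢ
    ; X-∘      = xˢ-∘ˢ
    ; ∘-X      = ∘ˢ-xˢ
    ; ∘-assoc  = ∘ˢ-assoc
    ; Null-X   = refl
    ; Null-neg = λ a₀ → trans (-‿cong a₀) -0#≈0#
    ; Null-*   = λ {a} b a₀ → trans (*ˢ-0 a b) (*-vanishˡ a₀)
    ; Null-∘   = λ {v} {w} v₀ w₀ → trans (∘ˢ-0 v w) v₀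
    }

-- Linear and quadratic polynomials with integer coefficients as series.

module IntegerSeries {c ℓ₁ ℓ₂} (k : HeytingField c ℓ₁ ℓ₂) where

  open Riordan k
  open SeriesRing k
  open HeytingCommutativeRing (HeytingField.heytingCommutativeRing k) using () renaming (commutativeRing to fieldRing)
  open CommutativeRing fieldRing using (_≈_; 1#; refl; sym; trans; +-cong; *-cong; -‿cong; semiring)
  open IntegerCoefficients fieldRing using (⟦_⟧; ⟦⟧-homo-+; ⟦⟧-homo-*; ⟦⟧-homo-‿)
  open Mult semiring using (×ᵤ≈×)
  open Substitution {p = ℓ₁} seriesRing using (quadratic; linear)

  -- The two maps use different definitions of multiples; this carries the homomorphism laws over to
  -- `fromℤ`.
  fromℤ≈⟦⟧ : ∀ i → fromℤ i ≈ ⟦ i ⟧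
  fromℤ≈⟦⟧ (+ n)    = ×ᵤ≈× n 1#
  fromℤ≈⟦⟧ -[1+ n ] = -‿cong (×ᵤ≈× (suc n) 1#)

  constℤ : ℤ → Series
  constℤ i = const (fromℤ i)

  constℤ-homo-+ : ∀ i j → constℤ (i ℤ.+ j) ≈ˢ constℤ i +ˢ constℤ j
  constℤ-homo-+ i j = S.trans
    (const-cong (trans (fromℤ≈⟦⟧ (i ℤ.+ j)) (trans (⟦⟧-homo-+ i j)
      (sym (+-cong (fromℤ≈⟦⟧ i) (fromℤ≈⟦⟧ j))))))
    (const-+ (fromℤ i) (fromℤ j))

  constℤ-homo-* : ∀ i j → constℤ (i ℤ.* j) ≈ˢ constℤ i *ˢ constℤ j
  constℤ-homo-* i j = S.trans
    (const-cong (trans (fromℤ≈⟦⟧ (i ℤ.* j)) (trans (⟦⟧-homo-* i j)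
      (sym (*-cong (fromℤ≈⟦⟧ i) (fromℤ≈⟦⟧ j))))))
    (const-*-const (fromℤ i) (fromℤ j))

  constℤ-homo-neg : ∀ i → constℤ (ℤ.- i) ≈ˢ -ˢ constℤ i
  constℤ-homo-neg i = S.trans
    (const-cong (trans (fromℤ≈⟦⟧ (ℤ.- i)) (trans (⟦⟧-homo-‿ i) (sym (-‿cong (fromℤ≈⟦⟧ i))))))
    (const-neg (fromℤ i))

  -- `flipped₁` and `flipped₂` provide the hypotheses `α′≈` and `β′≈` of `Flip`.
  flipped₁ : ∀ a c → constℤ (c ℤ.+ c ℤ.- a) ≈ˢ constℤ c +ˢ constℤ c +ˢ -ˢ constℤ a
  flipped₁ a c n = trans (constℤ-homo-+ (c ℤ.+ c) (ℤ.- a) n)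
    (+-cong (constℤ-homo-+ c c n) (constℤ-homo-neg a n))

  flipped₂ : ∀ a b c → constℤ (c ℤ.* c ℤ.- a ℤ.* c ℤ.+ b)
                       ≈ˢ constℤ c *ˢ constℤ c +ˢ -ˢ (constℤ a *ˢ constℤ c) +ˢ constℤ b
  flipped₂ a b c n = trans (constℤ-homo-+ (c ℤ.* c ℤ.- a ℤ.* c) b n)
    (+-cong (trans (constℤ-homo-+ (c ℤ.* c) (ℤ.- (a ℤ.* c)) n) (+-cong (constℤ-homo-* c c n)
      (trans (constℤ-homo-neg (a ℤ.* c) n) (-‿cong (constℤ-homo-* a c n))))) refl)

  linear-series : ∀ c → F₀.series 1+[ c ]x ≈ˢ linear (constℤ c) xˢ
  linear-series c n = trans (const+shift series n)
    (+-cong (sym (1≈const n)) (trans (*ˢ-cong {xˢ} S.refl tail≈ n) (*ˢ-comm xˢ (constℤ c) n)))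
    where
    open F₀ 1+[ c ]x
    tail≈ : tail series ≈ˢ constℤ c
    tail≈ zero          = refl
    -- This coefficient is `fromℤ 0ℤ`, which computes to `0#`.
    tail≈ (suc zero)    = refl
    tail≈ (suc (suc n)) = refl

  quadratic-series : ∀ a b → F₀.series 1+[ a ]x+[ b ]x² ≈ˢ quadratic (constℤ a) (constℤ b) xˢ
  quadratic-series a b n = begin
    series n
      ≈⟨ const+shift series n ⟩
    (const 1# +ˢ xˢ *ˢ tail series) n
      ≈⟨ +-cong (sym (1≈const n)) (*ˢ-cong {xˢ} S.refl
           (λ m → trans (const+shift (tail series) m) (+-cong refl (*ˢ-cong {xˢ} S.refl tail≈ m))) n) ⟩
    (1ˢ +ˢ xˢ *ˢ (constℤ a +ˢ xˢ *ˢ constℤ b)) n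
      ≈⟨ S.solve 4 (λ o x a b → o S.:+ x S.:* (a S.:+ x S.:* b) S.:= o S.:+ a S.:* x S.:+ b S.:* (x S.:* x))
           S.refl 1ˢ xˢ (constℤ a) (constℤ b) n ⟩
    quadratic (constℤ a) (constℤ b) xˢ n ∎
    where
    open SetoidReasoning (CommutativeRing.setoid fieldRing)
    open F₀ 1+[ a ]x+[ b ]x²
    tail≈ : tail (tail series) ≈ˢ constℤ b
    tail≈ zero    = refl
    tail≈ (suc n) = refl

-- From identities between series to involutions in the Riordan group.

module FlippedInvolution {c ℓ₁ ℓ₂} (k : HeytingField c ℓ₁ ℓ₂) where

  open Riordan k
  open SeriesRing k
  open IntegerSeries k
  open HeytingField k using (_≈_; 0#)
  open Substitution {p = ℓ₁} seriesRing using (quadratic; linear; module IsSubstitution)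
  open IsSubstitution isSubstitution

  -- The inverses enter only through their equations. `f̿` is there to make `f̄` a two-sided inverse
  -- of `f` by `left-inverse`.
  conjugate-isInvolution′ : ∀ (g r : F₀) (f f̄ f̿ h : F₁) {σ : Series} → σ 0 ≈ 0# →
    F₁.series f ∘ˢ F₁.series f̄ ≈ˢ xˢ → F₁.series f̄ ∘ˢ F₁.series f̿ ≈ˢ xˢ →
    F₀.series (g ∘₀ f̄) *ˢ F₀.series r ≈ˢ 1ˢ →
    σ ∘ˢ σ ≈ˢ xˢ → F₁.series h ≈ˢ F₁.series f ∘ˢ σ → F₀.series g *ˢ (F₀.series g ∘ˢ σ) ≈ˢ 1ˢ →
    IsInvolution ((r , f̄) ∙ (1₀ , h))
  conjugate-isInvolution′ g r f f̄ f̿ h {σ} σ₀ ff̄ f̄f̿ gr σσ h≈ gg = C.multiplier , C.involutive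
    where
    G = F₀.series g ∘ˢ F₁.series f̄
    R = F₀.series r
    I = 1ˢ ∘ˢ F₁.series f̄

    -- The first component of the array is `R *ˢ I`, because the product substitutes `f̄` into the
    -- `1ˢ` of the second array.
    m≈r : R *ˢ I ≈ˢ R
    m≈r = S.trans {R *ˢ I} {R *ˢ 1ˢ} {R} (S.*-congˡ {R} {I} {1ˢ} (1ˢ-∘ˢ (F₁.coeff₀ f̄))) (*ˢ-identityʳ R)

    module C = Conjugation {F₁.series f} {F₁.series f̄} {σ} {F₁.series h} {F₀.series g} {R *ˢ I}
      (F₁.coeff₀ f) (F₁.coeff₀ f̄) σ₀ (F₁.coeff₀ h) ff̄
      (left-inverse {F₁.series f} {F₁.series f̄} {F₁.series f̿}
        (F₁.coeff₀ f) (F₁.coeff₀ f̄) (F₁.coeff₀ f̿) ff̄ f̄f̿)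
      σσ h≈ gg (S.trans {G *ˢ (R *ˢ I)} {G *ˢ R} {1ˢ} (S.*-congˡ {G} {R *ˢ I} {R} m≈r) gr)

  -- Inverting `f` twice supplies the right inverse of `compInverse f`.
  conjugate-isInvolution : ∀ (g : F₀) (f h : F₁) {σ : Series} → σ 0 ≈ 0# →
    σ ∘ˢ σ ≈ˢ xˢ → F₁.series h ≈ˢ F₁.series f ∘ˢ σ → F₀.series g *ˢ (F₀.series g ∘ˢ σ) ≈ˢ 1ˢ →
    IsInvolution ((g , f) ⁻¹ ∙ (1₀ , h))
  conjugate-isInvolution g f h σ₀ = conjugate-isInvolution′ g (reciprocal (g ∘₀ compInverse f)) f
    (compInverse f) (compInverse (compInverse f)) h σ₀ (CompositionalInverse.inverseʳ f)
    (CompositionalInverse.inverseʳ (compInverse f)) (Reciprocal.inverseʳ (g ∘₀ compInverse f))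

  constℤ-constant : ∀ i → Constant (constℤ i)
  constℤ-constant i = const-∘ˢ (fromℤ i)

  module FlipSeries (a b c : ℤ) (D N e D⁻¹ N⁻¹ e⁻¹ : Series)
    (D≈ : D ≈ˢ quadratic (constℤ a) (constℤ b) xˢ)
    (N≈ : N ≈ˢ quadratic (constℤ (c ℤ.+ c ℤ.- a)) (constℤ (c ℤ.* c ℤ.- a ℤ.* c ℤ.+ b)) xˢ)
    (e≈ : e ≈ˢ linear (constℤ c) xˢ)
    (D*D⁻¹ : D *ˢ D⁻¹ ≈ˢ 1ˢ) (N*N⁻¹ : N *ˢ N⁻¹ ≈ˢ 1ˢ) (e*e⁻¹ : e *ˢ e⁻¹ ≈ˢ 1ˢ) where

    private
      module F = Flip {constℤ a} {constℤ b} {constℤ (c ℤ.+ c ℤ.- a)} {constℤ (c ℤ.* c ℤ.- a ℤ.* c ℤ.+ b)} {constℤ c}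
        (constℤ-constant a) (constℤ-constant b) (constℤ-constant (c ℤ.+ c ℤ.- a))
        (constℤ-constant (c ℤ.* c ℤ.- a ℤ.* c ℤ.+ b)) (constℤ-constant c) (flipped₁ a c) (flipped₂ a b c)
        {D} {N} {e} {D⁻¹} {N⁻¹} {e⁻¹} D≈ N≈ e≈ D*D⁻¹ N*N⁻¹ e*e⁻¹

    σ : Series
    σ = -ˢ xˢ *ˢ e⁻¹

    σ₀ : σ 0 ≈ 0#
    σ₀ = F.σ₀

    σ∘σ : σ ∘ˢ σ ≈ˢ xˢ
    σ∘σ = F.σ∘σ

    -- The series of `x∙ e` is `shift e`, to be identified with the product `xˢ *ˢ e`.
    h≈f∘σ : -ˢ shift e *ˢ N⁻¹ ≈ˢ (xˢ *ˢ D⁻¹) ∘ˢ σ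
    h≈f∘σ = S.trans { -ˢ shift e *ˢ N⁻¹} { -ˢ (xˢ *ˢ e) *ˢ N⁻¹} {(xˢ *ˢ D⁻¹) ∘ˢ σ}
      (S.*-congʳ {N⁻¹} { -ˢ shift e} { -ˢ (xˢ *ˢ e)}
        (S.-‿cong {shift e} {xˢ *ˢ e} (S.sym {xˢ *ˢ e} {shift e} (x*ˢ e))))
      F.h≈f∘σ

    g*g∘σ : N *ˢ D⁻¹ *ˢ ((N *ˢ D⁻¹) ∘ˢ σ) ≈ˢ 1ˢ
    g*g∘σ = F.g*g∘σ

  -- A definition, because names from an applied module are copies when they occur in a
  -- signature, and Agda would compare these with the originals by unfolding the recursions
  -- of reciprocal and compInverse.
  IsFlippedInvolution : (N D e : F₀) → Set ℓ₁
  IsFlippedInvolution N D e = IsInvolution ((N /₀ D , x₁ /₁ D) ⁻¹ ∙ (1₀ , -₁ (x∙ e) /₁ N))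

  -- `a′` and `b′` are tied to the flipped coefficients by equations, so that the coefficients of
  -- `N` may be written in another form.
  flipped-isInvolution : ∀ a b c {a′ b′} → a′ ≡ c ℤ.+ c ℤ.- a → b′ ≡ c ℤ.* c ℤ.- a ℤ.* c ℤ.+ b →
    ∀ (N D e : F₀) →
    F₀.series N ≈ˢ quadratic (constℤ a′) (constℤ b′) xˢ →
    F₀.series D ≈ˢ quadratic (constℤ a) (constℤ b) xˢ →
    F₀.series e ≈ˢ linear (constℤ c) xˢ →
    IsFlippedInvolution N D e
  flipped-isInvolution a b c ≡.refl ≡.refl N D e N≈ D≈ e≈ =
    conjugate-isInvolution (N /₀ D) (x₁ /₁ D) (-₁ (x∙ e) /₁ N) {E.σ} E.σ₀ E.σ∘σ E.h≈f∘σ E.g*g∘σ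
    where
    module E = FlipSeries a b c (F₀.series D) (F₀.series N) (F₀.series e)
      (F₀.series (reciprocal D)) (F₀.series (reciprocal N)) (F₀.series (reciprocal e))
      D≈ N≈ e≈ (Reciprocal.inverseʳ D) (Reciprocal.inverseʳ N) (Reciprocal.inverseʳ e)

-- The array with parameters `r`, `s`, `t`.

open import Data.Integer.Base using (-_; _+_; _-_; _*_)

-- Not inlined below for the same reason as IsFlippedInvolution.
Proposition13 : Setω
Proposition13 =
    ∀ {c ℓ₁ ℓ₂} (k : HeytingField c ℓ₁ ℓ₂) → let open Riordan k in
    CharacteristicZero →
    ∀ (r s t : ℤ) →
    let N = 1+[ - (r - + 2 * t) ]x+[ - (r * t - s - t * t) ]x²
        D = 1+[ r + + 2 * t ]x+[ r * t + s + t * t ]x²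
    in IsInvolution ((N /₀ D , x₁ /₁ D) ⁻¹ ∙ (1₀ , -₁ (x∙ 1+[ + 2 * t ]x) /₁ N))

proposition13 : Proposition13
proposition13 k _ r s t =
  flipped-isInvolution (r + + 2 * t) (r * t + s + t * t) (+ 2 * t) (coeff₁ r t) (coeff₂ r s t)
    1+[ - (r - + 2 * t) ]x+[ - (r * t - s - t * t) ]x² 1+[ r + + 2 * t ]x+[ r * t + s + t * t ]x² 1+[ + 2 * t ]x
    (quadratic-series (- (r - + 2 * t)) (- (r * t - s - t * t)))
    (quadratic-series (r + + 2 * t) (r * t + s + t * t)) (linear-series (+ 2 * t))
  where
  open Riordan k
  open IntegerSeries k
  open FlippedInvolution k

  -- With a = r + 2t, b = rt + s + t² and c = 2t, the flipped coefficients are 2c - a = 2t - r and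
  -- c² - ac + b = s + t² - rt, which are those of the numerator.
  coeff₁ : ∀ r t → - (r - + 2 * t) ≡ + 2 * t + + 2 * t - (r + + 2 * t)
  coeff₁ = solve-∀

  coeff₂ : ∀ r s t → - (r * t - s - t * t)
                     ≡ (+ 2 * t) * (+ 2 * t) - (r + + 2 * t) * (+ 2 * t) + (r * t + s + t * t)
  coeff₂ = solve-∀
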